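{- Let $x\geq 2$ and $c\geq 1$ be integers, let $\ell=2\lfloor\frac{x-1}{2}\rfloor$, let $a,b_2,b_4,\ldots,b_\ell\geq 0$ be integers, and let $$L=\{1^{a},2^{b_2},4^{b_4},6^{b_6},\ldots,\ell^{b_\ell},x^c\}$$ be an admissible list, where $v=|L|+1$. Then there exists a Hamiltonian path $H$ of $K_v$ with $\ell(H)=L$ in each of the following cases: (1) $x$ is even and $a\geq x-1$; (2) $x$ is odd and $a\geq 3x-4$.
   Context: $K_v$ is the complete graph on vertex set $\{0,1,\ldots,v-1\}$. The length of an edge $[x,y]$ is $\min(|x-y|,\,v-|x-y|)$, and for a subgraph $H$, $\ell(H)$ is the list (multiset) of lengths of its edges. The notation $\{1^{a_1},2^{a_2},\ldots,t^{a_t}\}$ denotes the multiset containing $a_i$ copies of $i$; $|L|$ is its total size. A list $L$ of $v-1$ positive integers not exceeding $\lfloor v/2\rfloor$ is called admissible if for every divisor $d$ of $v$, the number of elements of $L$ (with multiplicity) that are multiples of $d$ is at most $v-d$. -}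

module Defs where

open import Data.Nat using (ℕ; zero; suc; _+_; _*_; _∸_; _≤_; _⊓_; ∣_-_∣; _/_)
open import Data.Nat.Divisibility using (_∣_; _∣?_)
open import Data.List using (List; []; _∷_; _++_; length; filter; replicate; concatMap; upTo; applyUpTo)
open import Data.List.Relation.Unary.All using (All)
open import Data.List.Relation.Binary.Permutation.Propositional using (_↭_)
open import Data.Product using (_×_)
open import Relation.Binary.PropositionalEquality using (_≡_)

edgeLen : ℕ → ℕ → ℕ → ℕ
edgeLen v x y = ∣ x - y ∣ ⊓ (v ∸ ∣ x - y ∣)

pathLengths : ℕ → List ℕ → List ℕ
pathLengths v []           = []
pathLengths v (x ∷ [])     = []
pathLengths v (x ∷ y ∷ ps) = edgeLen v x y ∷ pathLengths v (y ∷ ps)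

HamiltonianPath : ℕ → List ℕ → Set
HamiltonianPath v ps = ps ↭ upTo v

countMultiples : ℕ → List ℕ → ℕ
countMultiples d L = length (filter (d ∣?_) L)

Admissible : ℕ → List ℕ → Set
Admissible v L =
  (length L ≡ v ∸ 1)
  × All (λ k → 1 ≤ k × k ≤ v / 2) L
  × (∀ d → d ∣ v → countMultiples d L ≤ v ∸ d)

-- the list {1^a, 2^{b_2}, 4^{b_4}, ..., ℓ^{b_ℓ}, x^c} with ℓ = 2⌊(x-1)/2⌋;
-- b k is the multiplicity of the even value k (only b 2, b 4, ..., b ℓ are used)
theList : (x a : ℕ) (b : ℕ → ℕ) (c : ℕ) → List ℕ
theList x a b c =
  replicate a 1
  ++ concatMap (λ i → replicate (b (2 * suc i)) (2 * suc i)) (upTo ((x ∸ 1) / 2))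
  ++ replicate c x

{-# OPTIONS --safe #-}
module Submission where

-- Since no length exceeds v/2, a path on {0,...,v-1} whose absolute differences form the list L
-- has cyclic length list L. For even x such a path is assembled from segments joining consecutive
-- integers 2i and 2i+1 above a common offset, the 2h endpoints of h segments being the top 2h
-- vertices so far. A new pair of top vertices either is a new segment, or continues the lowest
-- segment at both ends with two edges of length 2h; this produces every multiplicity up to its
-- parity. The odd multiplicities are settled when the segments are linked: the end next to a
-- window of n unused segments is joined to the near one by a unit edge or to the far one by an
-- edge of length 2n, so each even length is available once more. The resulting path has the
-- largest vertex p as an end, and unit edges can be added there. For odd x = 2h+1 the path for
-- the lengths below x is continued from p by c / x full rows of an array with x columns,
-- traversed column by column, and by a last part with c % x edges of length x; each of the two
-- continuations costs x - 1 unit edges.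

open import Defs
open import Algebra.Bundles using (CommutativeMonoid)
import Algebra.Construct.DirectProduct as DirectProduct
import Algebra.Solver.CommutativeMonoid as MonoidSolver
open import Data.Bool using (Bool; true; false; not; if_then_else_)
open import Data.List using (List; []; _∷_; _++_; [_]; length; map; replicate; reverse; concatMap; upTo; downFrom; applyDownFrom)
open import Data.List.Properties using (++-assoc; ++-identityʳ; length-downFrom; map-id-local; upTo-∷ʳ; concatMap-++; reverse-upTo)
import Data.List.Relation.Unary.All as All
open import Data.List.Relation.Binary.Permutation.Propositional using (_↭_; refl; prep; ↭-sym; ↭-trans; ↭-reflexive; module PermutationReasoning)
open import Data.List.Relation.Binary.Permutation.Propositional.Properties using (++-commutativeMonoid; ++⁺; ++⁺ˡ; ++⁺ʳ; ++-comm; map⁺; ↭-length; ↭-reverse; shift; shifts; drop-∷)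
open import Data.Nat using (ℕ; zero; suc; _+_; _*_; _∸_; _⊓_; _≤_; z≤n; s≤s; ∣_-_∣; _/_; _%_; ⌊_/2⌋)
open import Data.Nat.Properties
open import Data.Nat.Divisibility using (divides)
open import Data.Nat.DivMod
open import Data.Nat.Tactic.RingSolver using (solve-∀)
open import Algebra.Properties.CommutativeSemigroup +-commutativeSemigroup using (x∙yz≈y∙xz)
open import Data.Product using (_×_; _,_; proj₁; proj₂; ∃; ∃₂)
open import Data.Sum using (_⊎_; inj₁; inj₂)
open import Relation.Nullary.Decidable using (does; dec-true; dec-false)
open import Relation.Binary.PropositionalEquality using (_≡_; sym; trans; cong; cong₂; subst; module ≡-Reasoning) renaming (refl to ≡-refl)

private variable
  d h n p s t u s′ t′ lo T : ℕ

-- Walks weighted by their vertices and edge lengths.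

Weight : Set
Weight = List ℕ × List ℕ

-- Vertices and edge lengths form one product monoid, so a single call of the commutative monoid
-- solver rearranges both at once.
weights : CommutativeMonoid _ _
weights = DirectProduct.commutativeMonoid (++-commutativeMonoid {A = ℕ}) (++-commutativeMonoid {A = ℕ})

open CommutativeMonoid weights using (_≈_; ε; ∙-congˡ; ∙-congʳ; identityˡ; identityʳ; comm; assoc)
  renaming (_∙_ to infixr 7 _∙_; refl to ≈-refl; sym to ≈-sym; trans to ≈-trans)
open MonoidSolver weights using (solve; _⊜_; _⊕_)
open MonoidSolver (++-commutativeMonoid {A = ℕ}) using () renaming (solve to solveˡ; _⊜_ to infix 4 _⊜ˡ_; _⊕_ to infixr 5 _⊕ˡ_)

private variable
  m m′ m₁ m₂ : Weight
  V W K L : List ℕ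

vertex edge : ℕ → Weight
vertex n = [ n ] , []
edge d = [] , [ d ]

data Path : ℕ → ℕ → List ℕ → List ℕ → Set where
  stop : Path s s [ s ] []
  step : Path s′ t V L → Path s t (s ∷ V) (∣ s - s′ ∣ ∷ L)

append : Path s t V L → Path s′ t′ W K → Path s t′ (V ++ W) (L ++ ∣ t - s′ ∣ ∷ K)
append stop     q = step q
append (step p) q = step (append p q)

-- The weight records the vertices and the edge lengths as multisets.
record Walk (s t : ℕ) (m : Weight) : Set where
  constructor walk
  field
    {vertices lengths} : List ℕ
    path   : Path s t vertices lengths
    weight : (vertices , lengths) ≈ m

resp : m ≈ m′ → Walk s t m → Walk s t m′
resp eq (walk p w) = walk p (≈-trans w eq)

point : Walk s s (vertex s)
point = walk stop ≈-refl

join : ∣ t - s′ ∣ ≡ d → Walk s t m → Walk s′ t′ m′ → Walk s t′ (m ∙ edge d ∙ m′)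
join ≡-refl (walk p (v , l)) (walk p′ (v′ , l′)) = walk (append p p′) (++⁺ v v′ , ++⁺ l (prep _ l′))

goto : ∀ s′ → ∣ t - s′ ∣ ≡ d → Walk s t m → Walk s s′ ((vertex s′ ∙ edge d) ∙ m)
goto {d = d} {m = m} s′ eq w =
  resp (solve 3 (λ v e m → m ⊕ e ⊕ v ⊜ (v ⊕ e) ⊕ m) ≈-refl (vertex s′) (edge d) m) (join eq w point)

reverse-path : Path s t V L → Walk t s (V , L)
reverse-path stop = point
reverse-path (step {s′ = s′} {V = V} {L = L} {s = s} p) = goto s (∣-∣-comm s′ s) (reverse-path p)

reversed : Walk s t m → Walk t s m
reversed (walk p w) = resp w (reverse-path p)

gap : ∀ m n → ∣ m - n + m ∣ ≡ n
gap m n = trans (cong ∣ m -_∣ (+-comm n m)) (∣m-m+n∣≡n m n)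

gap′ : ∀ m n → ∣ n + m - m ∣ ≡ n
gap′ m n = trans (∣-∣-comm (n + m) m) (gap m n)

-- Families of segments with consecutive ends.

-- The i-th of the n segments joins lo + 2i to lo + 2i + 1.
data Segs (lo : ℕ) : ℕ → Weight → Set where
  none : m ≈ ε → Segs lo 0 m
  cons : Walk lo (suc lo) m₁ → Segs (2 + lo) n m₂ → m ≈ m₁ ∙ m₂ → Segs lo (suc n) m

resp-segs : m ≈ m′ → Segs lo n m → Segs lo n m′
resp-segs eq (none e)      = none (≈-trans (≈-sym eq) e)
resp-segs eq (cons w ss e) = cons w ss (≈-trans (≈-sym eq) e)

shift-lo : ∀ n lo → suc n * 2 + lo ≡ n * 2 + (2 + lo)
shift-lo n lo = sym (trans (+-suc (n * 2) (suc lo)) (cong suc (+-suc (n * 2) lo)))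

snoc : Segs lo n m → s ≡ n * 2 + lo → Walk s (suc s) m′ → Segs lo (suc n) (m ∙ m′)
snoc {m = m} {m′ = m′} (none e) ≡-refl w =
  cons w (none ≈-refl) (≈-trans (∙-congʳ e) (comm ε m′))
snoc {lo = lo} {n = suc n} {m′ = m′} (cons {m₁ = m₁} {m₂ = m₂} w ss e) ≡-refl w′ =
  cons w (snoc ss (shift-lo n lo) w′) (≈-trans (∙-congʳ e) (assoc m₁ m₂ m′))

-- Families are stored from the lowest segment upwards, but linking also has to take the topmost
-- segment first.
record Unsnoc (lo n : ℕ) (m : Weight) : Set where
  constructor unsnoc
  field
    {w-init w-last} : Weight
    initial : Segs lo n w-init
    last    : Walk (n * 2 + lo) (suc (n * 2 + lo)) w-last
    split   : m ≈ w-init ∙ w-last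

to-unsnoc : Segs lo (suc n) m → Unsnoc lo n m
to-unsnoc (cons {m₁ = m₁} {m₂ = m₂} w (none z) e) =
  unsnoc (none ≈-refl) w (≈-trans e (≈-trans (comm m₁ m₂) (∙-congʳ z)))
to-unsnoc {lo = lo} {n = suc n} (cons {m₁ = m₁} w ss@(cons _ _ _) e) with to-unsnoc ss
... | unsnoc {m₂} {m₃} ss′ w′ e′ =
  unsnoc (cons w ss′ ≈-refl) (subst (λ s → Walk s (suc s) m₃) (sym (shift-lo n lo)) w′)
         (≈-trans e (≈-trans (∙-congˡ {x = m₁} e′) (≈-sym (assoc m₁ m₂ m₃))))

-- Linking the segments into one walk.

jump : Bool → ℕ → ℕ
jump false n = 1
jump true  n = n * 2

-- Every link uses up one segment, so each window size from n down to 1 occurs exactly once. The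
-- lengths 2n, ..., 4, 2 can thus be taken or avoided independently.
jumps : (ℕ → Bool) → ℕ → List ℕ
jumps φ zero    = []
jumps φ (suc n) = jump (φ (suc n)) (suc n) ∷ jumps φ n

spiral-weight : ∀ m m₂ m₃ e L → m₁ ≈ m₂ ∙ m₃ →
  (m ∙ edge e ∙ m₂) ∙ m₃ ∙ ([] , L) ≈ m ∙ m₁ ∙ ([] , e ∷ L)
spiral-weight m m₂ m₃ e L eq = ≈-trans
  (solve 5 (λ m e m₂ m₃ l → (m ⊕ e ⊕ m₂) ⊕ m₃ ⊕ l ⊜ m ⊕ (m₂ ⊕ m₃) ⊕ e ⊕ l) ≈-refl
     m (edge e) m₂ m₃ ([] , L))
  (∙-congˡ {x = m} (∙-congʳ (≈-sym eq)))

nothing-left : ∀ m → m′ ≈ ε → m ≈ m ∙ m′ ∙ ε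
nothing-left {m′ = m′} m e = ≈-sym (≈-trans (∙-congˡ {x = m} (≈-trans (identityʳ m′) e)) (identityʳ m))

-- From a vertex adjacent to one end of the window of the n remaining segments, the next segment
-- is either the near one, reached by a unit edge, or the far one, reached by an edge of length 2n.
spiral↓ : ∀ φ n lo {u m m′} → Walk u (n * 2 + lo) m → Segs lo n m′ →
  ∃ λ t → Walk u t (m ∙ m′ ∙ ([] , jumps φ n))
spiral↑ : ∀ φ n p {u m m′} → Walk u p m → Segs (suc p) n m′ →
  ∃ λ t → Walk u t (m ∙ m′ ∙ ([] , jumps φ n))

spiral↓ φ zero lo {m = m} w (none e) = _ , resp (nothing-left m e) w
spiral↓ φ (suc n) lo {m = m} w ss with φ (suc n)
... | false with unsnoc {m₂} {m₃} ss′ w′ e ← to-unsnoc ss =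
  let t , w″ = spiral↓ φ n lo (join (gap′ (suc (n * 2 + lo)) 1) w (reversed w′)) ss′
  in t , resp (spiral-weight m m₃ m₂ 1 (jumps φ n) (≈-trans e (comm m₂ m₃))) w″
spiral↓ φ (suc n) lo {m = m} w (cons {m₁ = m₁} {m₂ = m₂} w′ ss e) | true =
  -- The far segment is left at its inner end, which touches the remaining window from the other
  -- side. The direction flips and the invariant is kept.
  let t , w″ = spiral↑ φ n (suc lo) (join (gap′ lo (suc n * 2)) w w′) ss
  in t , resp (spiral-weight m m₁ m₂ (suc n * 2) (jumps φ n) e) w″

spiral↑ φ zero p {m = m} w (none e) = _ , resp (nothing-left m e) w
spiral↑ φ (suc n) p {m = m} w ss with φ (suc n)
spiral↑ φ (suc n) p {m = m} w (cons {m₁ = m₁} {m₂ = m₂} w′ ss e) | false =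
  let t , w″ = spiral↑ φ n (2 + p) (join (gap p 1) w w′) ss
  in t , resp (spiral-weight m m₁ m₂ 1 (jumps φ n) e) w″
... | true with unsnoc {m₂} {m₃} ss′ w′ e ← to-unsnoc ss =
  let t , w″ = spiral↓ φ n (suc p) (join far w (reversed w′)) ss′
  in t , resp (spiral-weight m m₃ m₂ (suc n * 2) (jumps φ n) (≈-trans e (comm m₂ m₃))) w″
  where
  far : ∣ p - suc (n * 2 + suc p) ∣ ≡ suc n * 2
  far = trans (cong (λ k → ∣ p - suc k ∣) (+-suc (n * 2) p)) (gap p (suc n * 2))

-- Cores: even lengths in even multiplicity.

-- h segments through the vertices below T, with their ends at the topmost 2h of these.
Core : ℕ → ℕ → List ℕ → Set
Core T h L = ∃ λ lo → T ≡ h * 2 + lo × Segs lo h (downFrom T , L)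

widen : Core T h L → Core (2 + T) (suc h) (1 ∷ L)
widen {T = T} {L = L} (lo , eq , ss) = lo , cong (2 +_) eq , resp-segs
  (solve 4 (λ m a b e → m ⊕ (b ⊕ e) ⊕ a ⊜ b ⊕ a ⊕ e ⊕ m) ≈-refl
       (downFrom T , L) (vertex T) (vertex (suc T)) (edge 1))
  (snoc ss eq (goto (suc T) (gap T 1) point))

-- The 2(h + 1) ends are consecutive, so `T` and `T + 1` lie at distance 2(h + 1) from the two ends
-- of the lowest segment. Prolonged at both ends, that segment becomes the topmost one, and the
-- window of ends moves up by two.
rotate : Core T (suc h) L → Core (2 + T) (suc h) (suc h * 2 ∷ suc h * 2 ∷ L)
rotate {T = T} {h = h} {L = L} (lo , ≡-refl , cons {m₁ = m₁} {m₂ = m₂} w ss e) =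
  2 + lo , cong (2 +_) (shift-lo h lo) , resp-segs
  (≈-trans (solve 5 (λ m₁ m₂ a b e → m₂ ⊕ (b ⊕ e) ⊕ (a ⊕ e ⊕ m₁) ⊜ b ⊕ a ⊕ e ⊕ e ⊕ (m₁ ⊕ m₂)) ≈-refl
       m₁ m₂ (vertex T) (vertex (suc T)) (edge (suc h * 2)))
    (∙-congˡ {x = suc T ∷ T ∷ [] , suc h * 2 ∷ suc h * 2 ∷ []} (≈-sym e)))
  (snoc ss (shift-lo h lo) (goto (suc T) (gap lo (suc h * 2)) (join (gap′ lo (suc h * 2)) point w)))

-- Lengths of a core that makes `μ i` rotations while it has i segments; the 1 at each level is the
-- edge of the newly opened segment.
doubles : ℕ → (ℕ → ℕ) → List ℕ
doubles zero    μ = []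
doubles (suc h) μ = replicate (μ (suc h) * 2) (suc h * 2) ++ 1 ∷ doubles h μ

multiples : ℕ → (ℕ → ℕ) → List ℕ
multiples zero    β = []
multiples (suc h) β = replicate (β (suc h)) (suc h * 2) ++ multiples h β

rotations : ∀ k → Core T (suc h) L → ∃ λ T′ → Core T′ (suc h) (replicate (k * 2) (suc h * 2) ++ L)
rotations zero    c = _ , c
rotations (suc k) c = let _ , c′ = rotations k c in _ , rotate c′

core : ∀ h μ → ∃ λ T → Core T h (doubles h μ)
core zero    μ = 0 , 0 , ≡-refl , none ≈-refl
core (suc h) μ = let _ , c = core h μ in rotations (μ (suc h)) (widen c)

-- Arbitrary multiplicities by parity.

odd : ℕ → Bool
odd 0             = false
odd 1             = true
odd (suc (suc n)) = odd n

bit : Bool → ℕ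
bit b = if b then 1 else 0

bit+2⌊n/2⌋≡n : ∀ n → bit (odd n) + ⌊ n /2⌋ * 2 ≡ n
bit+2⌊n/2⌋≡n 0             = ≡-refl
bit+2⌊n/2⌋≡n 1             = ≡-refl
bit+2⌊n/2⌋≡n (suc (suc n)) = trans (+-suc (bit (odd n)) _)
  (cong suc (trans (+-suc (bit (odd n)) _) (cong suc (bit+2⌊n/2⌋≡n n))))

-- The number of unit edges in `jumps φ h`.
units : (ℕ → Bool) → ℕ → ℕ
units φ zero    = 0
units φ (suc h) = bit (not (φ (suc h))) + units φ h

units≤ : ∀ φ h → units φ h ≤ h
units≤ φ zero    = z≤n
units≤ φ (suc h) with φ (suc h)
... | true  = m≤n⇒m≤1+n (units≤ φ h)
... | false = s≤s (units≤ φ h)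

jumps-weight-step : ∀ b k h u D J M → D ++ J ↭ replicate (h + u) 1 ++ M →
  (replicate (k * 2) (n * 2) ++ 1 ∷ D) ++ jump b n ∷ J
    ↭ replicate (suc h + (bit (not b) + u)) 1 ++ replicate (bit b + k * 2) (n * 2) ++ M
jumps-weight-step {n = n} true k h u D J M eq = ↭-trans
  (solveˡ 5 (λ R o D d J → (R ⊕ˡ o ⊕ˡ D) ⊕ˡ d ⊕ˡ J ⊜ˡ o ⊕ˡ d ⊕ˡ R ⊕ˡ (D ⊕ˡ J)) refl
     (replicate (k * 2) (n * 2)) [ 1 ] D [ n * 2 ] J)
  (prep 1 (↭-trans (prep (n * 2) (++⁺ˡ (replicate (k * 2) (n * 2)) eq))
    (shifts (n * 2 ∷ replicate (k * 2) (n * 2)) (replicate (h + u) 1))))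
jumps-weight-step {n = n} false k h u D J M eq rewrite +-suc h u = ↭-trans
  (solveˡ 4 (λ R o D J → (R ⊕ˡ o ⊕ˡ D) ⊕ˡ o ⊕ˡ J ⊜ˡ o ⊕ˡ o ⊕ˡ R ⊕ˡ (D ⊕ˡ J)) refl
     (replicate (k * 2) (n * 2)) [ 1 ] D J)
  (prep 1 (prep 1 (↭-trans (++⁺ˡ (replicate (k * 2) (n * 2)) eq)
    (shifts (replicate (k * 2) (n * 2)) (replicate (h + u) 1)))))

halves : (ℕ → ℕ) → ℕ → ℕ
halves β i = ⌊ β i /2⌋

parities : (ℕ → ℕ) → ℕ → Bool
parities β i = odd (β i)

-- Rotations supply the even part of each `β i`, and the link entering a window of i segments
-- supplies the odd copy. Level i costs one unit edge for its segment, and a second one for the link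
-- when `β i` is even.
jumps-weight : ∀ h β → doubles h (halves β) ++ jumps (parities β) h
  ↭ replicate (h + units (parities β) h) 1 ++ multiples h β
jumps-weight zero    β = refl
jumps-weight (suc h) β = subst
  (λ c → doubles (suc h) (halves β) ++ jumps (parities β) (suc h)
    ↭ replicate (suc h + units (parities β) (suc h)) 1 ++ replicate c (suc h * 2) ++ multiples h β)
  (bit+2⌊n/2⌋≡n (β (suc h)))
  (jumps-weight-step {suc h} (odd (β (suc h))) ⌊ β (suc h) /2⌋ h (units (parities β) h)
    (doubles h (halves β)) (jumps (parities β) h) (multiples h β) (jumps-weight h β))

-- When the longest length has even multiplicity, no unit edge is spent on entering the first
-- segment: the walk starts at its upper end.
even-walk : ∀ k β → ∃₂ λ p t → ∃ λ u →
  u ≤ k + suc k × Walk t p (downFrom (suc p) , replicate u 1 ++ multiples (suc k) β)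
even-walk k β with core (suc k) (halves β) | odd (β (suc k)) in top
-- With odd multiplicity the walk starts at an additional vertex `T` above the core; its jump to
-- `lo` is the odd copy of the longest length.
... | T , lo , ≡-refl , ss | true =
  let t , w = spiral↓ φ (suc k) lo point ss
  in T , t , suc k + units φ (suc k) , few-units ,
     resp (prep T (↭-reflexive (++-identityʳ (downFrom T))) , jumps-weight (suc k) β) (reversed w)
  where
  φ = parities β
  few-units : suc k + units φ (suc k) ≤ k + suc k
  few-units = ≤-trans (+-monoʳ-≤ (suc k) (≤-trans
    (≤-reflexive (cong (λ b → bit (not b) + units φ k) top)) (units≤ φ k)))
    (≤-reflexive (+-comm (suc k) k))
... | T , lo , ≡-refl , ss | false with unsnoc {m₁} {m₂} ss′ w′ e ← to-unsnoc ss =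
  let t , w = spiral↓ φ k lo (reversed w′) ss′
  in suc (k * 2 + lo) , t , k + suc (units φ k) , +-monoʳ-≤ k (s≤s (units≤ φ k)) ,
     resp (≈-trans (solve 3 (λ a b c → a ⊕ b ⊕ c ⊜ (b ⊕ a) ⊕ c) ≈-refl m₂ m₁ ([] , jumps φ k))
          (≈-trans (∙-congʳ (≈-sym e))
            (↭-reflexive (++-identityʳ (downFrom T)) ,
             -- The general count includes a unit edge entering the topmost segment. This walk
             -- starts inside that segment, so one 1 is cancelled on both sides.
             drop-∷ (↭-trans (↭-sym (shift 1 D (jumps φ k))) lengths))))
       (reversed w)
  where
  φ = parities β
  D = doubles (suc k) (halves β)
  lengths : D ++ 1 ∷ jumps φ k ↭ replicate (suc k + suc (units φ k)) 1 ++ multiples (suc k) β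
  lengths = subst (λ b → D ++ jump b (suc k) ∷ jumps φ k
      ↭ replicate (suc k + (bit (not b) + units φ k)) 1 ++ multiples (suc k) β)
    top (jumps-weight (suc k) β)

-- Runs of unit edges.

run-up : ∀ n → Walk s p m → Walk s (n + p) ((applyDownFrom (λ j → suc (j + p)) n , replicate n 1) ∙ m)
run-up zero    w = w
run-up {p = p} (suc n) w = goto (suc (n + p)) (gap (n + p) 1) (run-up n w)

run-down : ∀ n → Walk s (n + p) m → Walk s p ((applyDownFrom (λ j → j + p) n , replicate n 1) ∙ m)
run-down {p = p} {m = m} zero    w = w
run-down {p = p} {m = m} (suc n) w = resp
  (solve 3 (λ r v m → r ⊕ v ⊕ m ⊜ (v ⊕ r) ⊕ m) ≈-refl
       (applyDownFrom (λ j → j + p) n , replicate n 1) ([ n + p ] , [ 1 ]) m)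
  (run-down n (goto (n + p) (gap′ (n + p) 1) w))

downFrom-++ : ∀ n p → applyDownFrom (λ j → j + p) n ++ downFrom p ≡ downFrom (n + p)
downFrom-++ zero    p = ≡-refl
downFrom-++ (suc n) p = cong (n + p ∷_) (downFrom-++ n p)

downFrom-++′ : ∀ n p → applyDownFrom (λ j → suc (j + p)) n ++ downFrom (suc p) ≡ downFrom (suc (n + p))
downFrom-++′ zero    p = ≡-refl
downFrom-++′ (suc n) p = cong (suc (n + p) ∷_) (downFrom-++′ n p)

extend : ∀ n → Walk s p (downFrom (suc p) , L) → Walk s (n + p) (downFrom (suc (n + p)) , replicate n 1 ++ L)
extend {p = p} n w = resp (↭-reflexive (downFrom-++′ n p) , refl) (run-up n w)

prep-≡ : s ≡ t → V ↭ W → s ∷ V ↭ t ∷ W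
prep-≡ {s = s} ≡-refl eq = prep s eq

end-at : t ≡ t′ → Walk s t m → Walk s t′ m
end-at ≡-refl w = w

replicate-++ : ∀ k n (d : ℕ) → replicate k d ++ replicate n d ≡ replicate (k + n) d
replicate-++ zero    n d = ≡-refl
replicate-++ (suc k) n d = cong (d ∷_) (replicate-++ k n d)

-- Full rows of edges of odd length.

-- The column of height q + 1 and step x with bottom s, without its bottom.
tower : ℕ → ℕ → ℕ → Weight
tower x q s = applyDownFrom (λ i → s + suc i * x) q , replicate q x

climb : ∀ x q → Walk u s m → Walk u (s + q * x) (tower x q s ∙ m)
climb {s = s} x zero    w = end-at (sym (+-identityʳ s)) w
climb {s = s} x (suc q) w = goto (s + suc q * x)
  (trans (∣m+n-m+o∣≡∣n-o∣ s (q * x) (suc q * x)) (gap (q * x) x)) (climb x q w)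

-- The columns over p + 1, ..., p + n, each with its bottom and one unit edge that connects it to
-- the preceding column.
columns : ℕ → ℕ → ℕ → ℕ → Weight
columns x q p zero    = ε
columns x q p (suc n) = (vertex (suc (n + p)) ∙ edge 1 ∙ tower x q (suc (n + p))) ∙ columns x q p n

-- Columns are taken in pairs, down the first and up the second, so the walk is at the top again.
-- For x = 2h + 1 these 2h columns and the one over `p` make up a whole array, and the walk stops at
-- its largest vertex.
snake : ∀ x q h → Walk s (p + q * x) m → Walk s (h * 2 + p + q * x) (columns x q p (h * 2) ∙ m)
snake x q zero    w = w
snake {p = p} {m = m} x q (suc h) w = resp
  (solve 7 (λ a b e A B c m → B ⊕ (b ⊕ e) ⊕ ((c ⊕ m) ⊕ e ⊕ A ⊕ a) ⊜ ((b ⊕ e ⊕ B) ⊕ (a ⊕ e ⊕ A) ⊕ c) ⊕ m) ≈-refl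
     (vertex (suc k)) (vertex (2 + k)) (edge 1) (tower x q (suc k)) (tower x q (2 + k))
     (columns x q p (h * 2)) m)
  (climb x q (goto (2 + k) (gap k 1)
    (join (gap (k + q * x) 1) (snake x q h w) (reversed (climb x q (point {suc k}))))))
  where k = h * 2 + p

-- The tops of adjacent columns are consecutive, so raising every column by one adds an interval of
-- vertices and one edge of length x per column.
add-row : ∀ x q p n → columns x (suc q) p n ∙ tower x (suc q) p ≈
  (applyDownFrom (λ j → j + (p + suc q * x)) (suc n) , replicate (suc n) x) ∙ columns x q p n ∙ tower x q p
add-row x q p zero    = ≈-refl
add-row x q p (suc n) = ≈-trans
  (solve 4 (λ a b c e → (a ⊕ b ⊕ c) ⊕ e ⊜ (a ⊕ b) ⊕ (c ⊕ e)) ≈-refl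
     a (v ∙ b) (columns x (suc q) p n) (tower x (suc q) p))
  (≈-trans (≈-trans (∙-congˡ {x = a ∙ v ∙ b} (add-row x q p n))
  (solve 6 (λ a v b r c e → (a ⊕ v ⊕ b) ⊕ r ⊕ c ⊕ e ⊜ (v ⊕ r) ⊕ (a ⊕ b ⊕ c) ⊕ e) ≈-refl
     a v b row (columns x q p n) (tower x q p)))
  (prep-≡ (cong suc (+-assoc n p (suc q * x))) refl , refl))
  where
  a = vertex (suc (n + p)) ∙ edge 1
  b = tower x q (suc (n + p))
  v = vertex (suc (n + p) + suc q * x) ∙ edge x
  row = applyDownFrom (λ j → j + (p + suc q * x)) (suc n) , replicate (suc n) x

-- With exactly x = n + 1 columns each row begins where the row below it ends, so the array fills an
-- interval. The induction is on the number of rows.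
all-columns : ∀ q p n {L} → columns (suc n) q p n ∙ tower (suc n) q p ∙ (downFrom (suc p) , L) ≈
  (downFrom (suc n + (p + q * suc n)) , replicate n 1 ++ replicate (q * suc n) (suc n) ++ L)
all-columns zero p n {L} = start n
  where
  start : ∀ k → columns (suc n) 0 p k ∙ ε ∙ (downFrom (suc p) , L) ≈
    (downFrom (suc k + (p + 0)) , replicate k 1 ++ L)
  start zero    rewrite +-identityʳ p = ≈-refl
  start (suc k) =
    ≈-trans (∙-congˡ {x = vertex (suc (k + p)) ∙ edge 1} (start k))
      (prep-≡ (cong (λ e → suc (k + e)) (sym (+-identityʳ p))) refl , refl)
all-columns (suc q) p n {L} = ≈-trans
  (≈-trans (≈-sym (assoc (columns (suc n) (suc q) p n) (tower (suc n) (suc q) p) _))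
    (≈-trans (∙-congʳ (add-row (suc n) q p n))
   (≈-trans (solve 4 (λ r c e d → (r ⊕ c ⊕ e) ⊕ d ⊜ r ⊕ (c ⊕ e ⊕ d)) ≈-refl
        row (columns (suc n) q p n) (tower (suc n) q p) (downFrom (suc p) , L))
     (∙-congˡ {x = row} (all-columns q p n)))))
  (↭-reflexive (trans (cong (λ k → applyDownFrom (λ j → j + (p + suc q * suc n)) (suc n) ++ downFrom k)
        (sym next))
      (downFrom-++ (suc n) (p + suc q * suc n))) ,
   ↭-trans (shifts (replicate (suc n) (suc n)) (replicate n 1))
     (++⁺ˡ (replicate n 1) (↭-reflexive (trans (sym (++-assoc (replicate (suc n) (suc n)) _ L))
       (cong (_++ L) (replicate-++ (suc n) (q * suc n) (suc n)))))))
  where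
  row = applyDownFrom (λ j → j + (p + suc q * suc n)) (suc n) , replicate (suc n) (suc n)
  next : p + suc q * suc n ≡ suc n + (p + q * suc n)
  next = x∙yz≈y∙xz p (suc n) (q * suc n)

full-rows : ∀ h q → Walk s p (downFrom (suc p) , L) →
  Walk s (h * 2 + (p + q * suc (h * 2))) (downFrom (suc (h * 2 + (p + q * suc (h * 2)))) ,
    replicate (h * 2) 1 ++ replicate (q * suc (h * 2)) (suc (h * 2)) ++ L)
full-rows {p = p} h q w = end-at (+-assoc (h * 2) p _)
  (resp (all-columns q p (h * 2)) (snake (suc (h * 2)) q h (climb (suc (h * 2)) q w)))

-- The remaining edges of odd length.

-- For y = x + p or x + p + 1, pairs of consecutive vertices at p and at y are joined by edges of
-- length x; i pairs at each level.
hops : ℕ → ℕ → ℕ → ℕ → Weight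
hops x p y zero    = ε
hops x p y (suc i) =
  (2 + (i * 2 + p) ∷ suc (i * 2 + p) ∷ suc (i * 2 + y) ∷ i * 2 + y ∷ [] , 1 ∷ x ∷ 1 ∷ x ∷ []) ∙ hops x p y i

hops-weight : ∀ x p y i → hops x p y i ≈
  (applyDownFrom (λ j → suc (j + p)) (i * 2) , replicate (i * 2) 1) ∙
  (applyDownFrom (λ j → j + y) (i * 2) , replicate (i * 2) x)
hops-weight x p y zero    = ≈-refl
hops-weight x p y (suc i) = ≈-trans (∙-congˡ {x = _ , _} (hops-weight x p y i))
  (++⁺ˡ (2 + (i * 2 + p) ∷ suc (i * 2 + p) ∷ [])
     (shifts (suc (i * 2 + y) ∷ i * 2 + y ∷ []) (applyDownFrom (λ j → suc (j + p)) (i * 2))) ,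
   solveˡ 4 (λ o x a b → o ⊕ˡ x ⊕ˡ o ⊕ˡ x ⊕ˡ a ⊕ˡ b ⊜ˡ (o ⊕ˡ o ⊕ˡ a) ⊕ˡ (x ⊕ˡ x ⊕ˡ b)) refl
        [ 1 ] [ x ] (replicate (i * 2) 1) (replicate (i * 2) x))

level : ∀ k x p → ∣ k + p - k + (x + p) ∣ ≡ x
level k x p = trans (∣m+n-m+o∣≡∣n-o∣ k p (x + p)) (gap p x)

level′ : ∀ k x p → ∣ k + (x + p) - k + p ∣ ≡ x
level′ k x p = trans (∣-∣-comm (k + (x + p)) (k + p)) (level k x p)

hop-up : ∀ x i → Walk s p m → Walk s (i * 2 + p) (hops x p (x + p) i ∙ m)
hop-up x zero    w = w
hop-up {p = p} x (suc i) w =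
  goto (2 + (i * 2 + p)) (gap (i * 2 + p) 1)
  (goto (suc (i * 2 + p)) (level′ (i * 2) x p)
  (goto (suc (i * 2 + (x + p))) (gap (i * 2 + (x + p)) 1)
  (goto (i * 2 + (x + p)) (level (i * 2) x p) (hop-up x i w))))

-- The zigzag in descending order. The upper level starts at x + p + 1, which leaves x + p free for
-- the edge that first reaches that level.
hop-down : ∀ x i → Walk s (suc (i * 2 + p)) m → Walk s (suc p) (hops x p (suc (x + p)) i ∙ m)
hop-down x zero    w = w
hop-down {p = p} {m = m} x (suc i) w = resp
  (solve 8 (λ h a b c d o e m → h ⊕ (b ⊕ e) ⊕ (d ⊕ o) ⊕ (c ⊕ e) ⊕ (a ⊕ o) ⊕ m
      ⊜ ((a ⊕ o) ⊕ (b ⊕ e) ⊕ (c ⊕ o) ⊕ d ⊕ e ⊕ h) ⊕ m) ≈-refl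
    (hops x p y i) (vertex (2 + (i * 2 + p))) (vertex (suc (i * 2 + p)))
    (vertex (suc (i * 2 + y))) (vertex (i * 2 + y))
    (edge 1) (edge x) m)
  (hop-down x i
  (goto (suc (i * 2 + p))
    (trans (cong (λ k → ∣ k - suc (i * 2 + p) ∣) (+-suc (i * 2) (x + p))) (level′ (i * 2) x p))
  (goto (i * 2 + y) (gap′ (i * 2 + y) 1)
  (goto (suc (i * 2 + y))
    (trans (cong (λ k → ∣ suc (i * 2 + p) - k ∣) (+-suc (i * 2) (x + p))) (level (i * 2) x p))
  (goto (2 + (i * 2 + p)) (gap′ (2 + (i * 2 + p)) 1) w)))))
  where
  y = suc (x + p)

-- The hops cover p + 1, ..., p + 2i and the 2i vertices from x + p on. A run of n unit edges then
-- fills the gap between the two blocks.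
even-remainder : ∀ n i {p L} → let x = suc (n + i * 2) in Walk s p (downFrom (suc p) , L) →
  ∃ λ t → Walk s t (downFrom (i * 2 + (x + p)) , replicate (n + i * 2) 1 ++ replicate (i * 2) x ++ L)
even-remainder n i {p} {L} w = _ , resp (≈-trans
  (∙-congˡ {x = run} (≈-trans (∙-congʳ (hops-weight x p (x + p) i))
     (≈-trans (assoc lower upper (downFrom (suc p) , L))
     (solve 3 (λ a b c → a ⊕ b ⊕ c ⊜ b ⊕ a ⊕ c) ≈-refl lower upper (downFrom (suc p) , L)))))
  (vertices≡ , lengths↭))
  (run-up n (hop-up x i w))
  where
  x = suc (n + i * 2)
  run = applyDownFrom (λ j → suc (j + (i * 2 + p))) n , replicate n 1
  lower = applyDownFrom (λ j → suc (j + p)) (i * 2) , replicate (i * 2) 1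
  upper = applyDownFrom (λ j → j + (x + p)) (i * 2) , replicate (i * 2) x
  vertices≡ : proj₁ run ++ proj₁ upper ++ proj₁ lower ++ downFrom (suc p) ↭ downFrom (i * 2 + (x + p))
  vertices≡ = begin
    proj₁ run ++ proj₁ upper ++ proj₁ lower ++ downFrom (suc p)
      ↭⟨ shifts (proj₁ run) (proj₁ upper) ⟩
    proj₁ upper ++ proj₁ run ++ proj₁ lower ++ downFrom (suc p)
      ≡⟨ cong (λ V → proj₁ upper ++ proj₁ run ++ V) (downFrom-++′ (i * 2) p) ⟩
    proj₁ upper ++ proj₁ run ++ downFrom (suc (i * 2 + p))
      ≡⟨ cong (proj₁ upper ++_) (downFrom-++′ n (i * 2 + p)) ⟩
    proj₁ upper ++ downFrom (suc (n + (i * 2 + p)))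
      ≡⟨ cong (λ k → proj₁ upper ++ downFrom (suc k)) (+-assoc n (i * 2) p) ⟨
    proj₁ upper ++ downFrom (x + p) ≡⟨ downFrom-++ (i * 2) (x + p) ⟩
    downFrom (i * 2 + (x + p)) ∎
    where open PermutationReasoning
  lengths↭ : proj₂ run ++ proj₂ upper ++ proj₂ lower ++ L ↭ replicate (n + i * 2) 1 ++ replicate (i * 2) x ++ L
  lengths↭ = begin
    proj₂ run ++ proj₂ upper ++ proj₂ lower ++ L
      ↭⟨ solveˡ 4 (λ a b c l → a ⊕ˡ b ⊕ˡ c ⊕ˡ l ⊜ˡ (a ⊕ˡ c) ⊕ˡ b ⊕ˡ l) refl
         (proj₂ run) (proj₂ upper) (proj₂ lower) L ⟩
    (proj₂ run ++ proj₂ lower) ++ proj₂ upper ++ L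
      ≡⟨ cong (_++ proj₂ upper ++ L) (replicate-++ n (i * 2) 1) ⟩
    replicate (n + i * 2) 1 ++ proj₂ upper ++ L ∎
    where open PermutationReasoning

-- An odd number of edges x cannot both leave and regain the lower level by hops alone. So one edge
-- x goes first, from `p` to x + p; unit edges descend through the gap, and the hops run downwards,
-- ending at p + 1.
odd-remainder : ∀ n i {p L} → let r = suc (i * 2) ; x = suc (n + r) in Walk s p (downFrom (suc p) , L) →
  ∃ λ t → Walk s t (downFrom (r + (x + p)) , replicate (n + r) 1 ++ replicate r x ++ L)
odd-remainder n i {p} {L} w = _ , resp (≈-trans
  (≈-trans (∙-congʳ (hops-weight x p (suc (x + p)) i))
    (solve 5 (λ a b r e c → (a ⊕ b) ⊕ r ⊕ e ⊕ c ⊜ b ⊕ e ⊕ r ⊕ a ⊕ c) ≈-refl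
      lower upper run (vertex (x + p) ∙ edge x) (downFrom (suc p) , L)))
  (vertices≡ , lengths↭))
  (hop-down x i (run-down (suc n) (end-at (cong suc (+-assoc n r p))
    (goto (x + p) (gap p x) w))))
  where
  r = suc (i * 2)
  x = suc (n + r)
  run = applyDownFrom (λ j → j + (r + p)) (suc n) , replicate (suc n) 1
  lower = applyDownFrom (λ j → suc (j + p)) (i * 2) , replicate (i * 2) 1
  upper = applyDownFrom (λ j → j + suc (x + p)) (i * 2) , replicate (i * 2) x
  vertices≡ : proj₁ upper ++ x + p ∷ proj₁ run ++ proj₁ lower ++ downFrom (suc p) ↭ downFrom (r + (x + p))
  vertices≡ = ↭-reflexive (begin
    proj₁ upper ++ x + p ∷ proj₁ run ++ proj₁ lower ++ downFrom (suc p)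
      ≡⟨ cong (λ V → proj₁ upper ++ x + p ∷ proj₁ run ++ V) (downFrom-++′ (i * 2) p) ⟩
    proj₁ upper ++ x + p ∷ proj₁ run ++ downFrom (r + p)
      ≡⟨ cong (λ V → proj₁ upper ++ x + p ∷ V) (downFrom-++ (suc n) (r + p)) ⟩
    proj₁ upper ++ x + p ∷ downFrom (suc n + (r + p))
      ≡⟨ cong (λ k → proj₁ upper ++ x + p ∷ downFrom (suc k)) (+-assoc n r p) ⟨
    proj₁ upper ++ downFrom (suc (x + p)) ≡⟨ downFrom-++ (i * 2) (suc (x + p)) ⟩
    downFrom (i * 2 + suc (x + p)) ≡⟨ cong downFrom (+-suc (i * 2) (x + p)) ⟩
    downFrom (r + (x + p)) ∎)
    where open ≡-Reasoning
  lengths↭ : proj₂ upper ++ x ∷ proj₂ run ++ proj₂ lower ++ L ↭ replicate (n + r) 1 ++ replicate r x ++ L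
  lengths↭ = begin
    proj₂ upper ++ x ∷ proj₂ run ++ proj₂ lower ++ L
      ↭⟨ solveˡ 5 (λ a x b c l → a ⊕ˡ x ⊕ˡ b ⊕ˡ c ⊕ˡ l ⊜ˡ (b ⊕ˡ c) ⊕ˡ x ⊕ˡ a ⊕ˡ l) refl
         (proj₂ upper) [ x ] (proj₂ run) (proj₂ lower) L ⟩
    (proj₂ run ++ proj₂ lower) ++ x ∷ proj₂ upper ++ L
      ≡⟨ cong (_++ x ∷ proj₂ upper ++ L) (replicate-++ (suc n) (i * 2) 1) ⟩
    replicate (suc n + i * 2) 1 ++ replicate r x ++ L
      ≡⟨ cong (λ k → replicate k 1 ++ replicate r x ++ L) (+-suc n (i * 2)) ⟨
    replicate (n + r) 1 ++ replicate r x ++ L ∎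
    where open PermutationReasoning

remainder : ∀ n r → Walk s p (downFrom (suc p) , L) →
  ∃ λ t → Walk s t (downFrom (r + (suc (n + r) + p)) , replicate (n + r) 1 ++ replicate r (suc (n + r)) ++ L)
remainder n r w with odd r | ⌊ r /2⌋ | bit+2⌊n/2⌋≡n r
... | false | i | ≡-refl = even-remainder n i w
... | true  | i | ≡-refl = odd-remainder n i w

odd-extension : ∀ h c → Walk s p (downFrom (suc p) , L) → ∃₂ λ N t →
  Walk s t (downFrom N , replicate (h * 2 + h * 2) 1 ++ replicate c (suc (h * 2)) ++ L)
odd-extension {s = s} {L = L} h c w =
  let t , w′ = w₀
  in _ , t , resp (refl , lengths↭)
    -- The remainder is built for the step n + r + 1; the choice n = 2h - r, possible because r < x,
    -- makes this step equal to x.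
    (subst (λ k → Walk s t (downFrom (r + (suc k + p′)) , replicate k 1 ++ replicate r (suc k) ++ L′)) n+r w′)
  where
  x = suc (h * 2)
  r = c % x
  q = c / x
  p′ = h * 2 + (_ + q * x)
  L′ = replicate (h * 2) 1 ++ replicate (q * x) x ++ L
  n+r : h * 2 ∸ r + r ≡ h * 2
  n+r = m∸n+n≡m (m<1+n⇒m≤n (m%n<n c x))
  w₀ = remainder (h * 2 ∸ r) r (full-rows h q w)
  lengths↭ : replicate (h * 2) 1 ++ replicate r x ++ L′ ↭ replicate (h * 2 + h * 2) 1 ++ replicate c x ++ L
  lengths↭ = begin
    replicate (h * 2) 1 ++ replicate r x ++ L′
      ↭⟨ solveˡ 4 (λ a b c l → a ⊕ˡ b ⊕ˡ a ⊕ˡ c ⊕ˡ l ⊜ˡ (a ⊕ˡ a) ⊕ˡ (b ⊕ˡ c) ⊕ˡ l) refl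
           (replicate (h * 2) 1) (replicate r x) (replicate (q * x) x) L ⟩
    (replicate (h * 2) 1 ++ replicate (h * 2) 1) ++ (replicate r x ++ replicate (q * x) x) ++ L
      ≡⟨ cong₂ (λ A B → A ++ B ++ L) (replicate-++ (h * 2) (h * 2) 1) (replicate-++ r (q * x) x) ⟩
    replicate (h * 2 + h * 2) 1 ++ replicate (r + q * x) x ++ L
      ≡⟨ cong (λ k → replicate (h * 2 + h * 2) 1 ++ replicate k x ++ L) (m≡m%n+[m/n]*n c x) ⟨
    replicate (h * 2 + h * 2) 1 ++ replicate c x ++ L ∎
    where open PermutationReasoning

-- Walks for the required lists.

even-walk-padded : ∀ k β a → k + suc k ≤ a →
  ∃₂ λ p t → Walk t p (downFrom (suc p) , replicate a 1 ++ multiples (suc k) β)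
even-walk-padded k β a k+1+k≤a =
  let p , t , u , u≤ , w = even-walk k β
  in _ , t , resp (refl , ↭-reflexive (trans (sym (++-assoc (replicate (a ∸ u) 1) (replicate u 1) _))
       (cong (_++ multiples (suc k) β) (trans (replicate-++ (a ∸ u) u 1)
         (cong (λ n → replicate n 1) (m∸n+n≡m (≤-trans u≤ k+1+k≤a)))))))
     (extend (a ∸ u) w)

multiples-cong : ∀ k {β γ} → (∀ {i} → i ≤ k → β i ≡ γ i) → multiples k β ≡ multiples k γ
multiples-cong zero    β≡γ = ≡-refl
multiples-cong (suc k) β≡γ = cong₂ (λ n M → replicate n (suc k * 2) ++ M) (β≡γ ≤-refl)
  (multiples-cong k (λ i≤k → β≡γ (m≤n⇒m≤1+n i≤k)))

multiples-concatMap : ∀ k (b : ℕ → ℕ) →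
  multiples k (λ i → b (2 * i)) ↭ concatMap (λ i → replicate (b (2 * suc i)) (2 * suc i)) (upTo k)
multiples-concatMap zero    b = refl
multiples-concatMap (suc k) b = begin
  g′ ++ multiples k (λ i → b (2 * i)) ↭⟨ ++-comm g′ _ ⟩
  multiples k (λ i → b (2 * i)) ++ g′ ↭⟨ ++⁺ʳ g′ (multiples-concatMap k b) ⟩
  concatMap g (upTo k) ++ g′
    ≡⟨ cong (λ d → concatMap g (upTo k) ++ replicate (b (2 * suc k)) d) (*-comm (suc k) 2) ⟩
  concatMap g (upTo k) ++ g k ≡⟨ cong (concatMap g (upTo k) ++_) (++-identityʳ (g k)) ⟨
  concatMap g (upTo k) ++ concatMap g [ k ] ≡⟨ concatMap-++ g (upTo k) [ k ] ⟨
  concatMap g (upTo k ++ [ k ]) ≡⟨ cong (concatMap g) (upTo-∷ʳ k) ⟩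
  concatMap g (upTo (suc k)) ∎
  where
  open PermutationReasoning
  g = λ i → replicate (b (2 * suc i)) (2 * suc i)
  g′ = replicate (b (2 * suc k)) (suc k * 2)

even-case : ∀ k c a b → suc (k * 2) ≤ a →
  ∃₂ λ N s → ∃ λ t → Walk s t (downFrom N , theList (suc k * 2) a b c)
even-case k c a b a≥ =
  let p , t , w = even-walk-padded k β a (subst (_≤ a) (1+2k k) a≥)
  in suc p , t , p , resp (refl , ++⁺ˡ (replicate a 1) lengths↭) w
  where
  open PermutationReasoning
  1+2k : ∀ k → suc (k * 2) ≡ k + suc k
  1+2k = solve-∀
  x = suc k * 2
  g = λ i → replicate (b (2 * suc i)) (2 * suc i)
  β : ℕ → ℕ
  -- For even x the length x is merely the longest even length, with index k + 1 and multiplicity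
  -- `c`.
  β i = if does (i ≤? k) then b (2 * i) else c
  lengths↭ : multiples (suc k) β ↭ concatMap g (upTo ((x ∸ 1) / 2)) ++ replicate c x
  lengths↭ = begin
    replicate (β (suc k)) x ++ multiples k β
      ≡⟨ cong₂ (λ n M → replicate n x ++ M)
           (cong (λ e → if e then b (2 * suc k) else c) (dec-false (suc k ≤? k) (<-irrefl ≡-refl)))
           (multiples-cong k (λ {i} i≤k → cong (λ e → if e then b (2 * i) else c) (dec-true (i ≤? k) i≤k))) ⟩
    replicate c x ++ multiples k (λ i → b (2 * i)) ↭⟨ ++-comm (replicate c x) _ ⟩
    multiples k (λ i → b (2 * i)) ++ replicate c x
      ↭⟨ ++⁺ʳ (replicate c x) (multiples-concatMap k b) ⟩
    concatMap g (upTo k) ++ replicate c x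
      ≡⟨ cong (λ n → concatMap g (upTo n) ++ replicate c x)
           (trans (+-distrib-/-∣ʳ 1 {d = 2} (divides k ≡-refl)) (m*n/n≡m k 2)) ⟨
    concatMap g (upTo ((x ∸ 1) / 2)) ++ replicate c x ∎

odd-case : ∀ k c a b → let x = suc (suc k * 2) in 3 * x ∸ 4 ≤ a →
  ∃₂ λ N s → ∃ λ t → Walk s t (downFrom N , theList x a b c)
odd-case k c a b a≥ =
  let _ , s , w = even-walk-padded k β a′ (m+n≤o⇒m≤o∸n (k + suc k) enough)
      N , t , w′ = odd-extension j c w
  in N , s , t , resp (refl , lengths↭) w′
  where
  open PermutationReasoning
  j = suc k
  x = suc (j * 2)
  g = λ i → replicate (b (2 * suc i)) (2 * suc i)
  β = λ i → b (2 * i)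
  r = j * 2 + j * 2
  a′ = a ∸ r
  -- The bound is 3x - 4 = (x - 2) + 2(x - 1): x - 2 units suffice for the even lengths up to x - 1,
  -- and each of the two continuations takes x - 1.
  unit-count : ∀ k → 3 * suc (suc k * 2) ≡ 4 + ((k + suc k) + (suc k * 2 + suc k * 2))
  unit-count = solve-∀
  enough : (k + suc k) + r ≤ a
  enough = subst (λ n → n ∸ 4 ≤ a) (unit-count k) a≥
  lengths↭ : replicate r 1 ++ replicate c x ++ replicate a′ 1 ++ multiples j β ↭ theList x a b c
  lengths↭ = begin
    replicate r 1 ++ replicate c x ++ replicate a′ 1 ++ multiples j β
      ↭⟨ solveˡ 4 (λ u c a m → u ⊕ˡ c ⊕ˡ a ⊕ˡ m ⊜ˡ (u ⊕ˡ a) ⊕ˡ m ⊕ˡ c) refl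
           (replicate r 1) (replicate c x) (replicate a′ 1) (multiples j β) ⟩
    (replicate r 1 ++ replicate a′ 1) ++ multiples j β ++ replicate c x
      ≡⟨ cong (_++ multiples j β ++ replicate c x) (trans (replicate-++ r a′ 1)
           (cong (λ n → replicate n 1) (m+[n∸m]≡n (m+n≤o⇒n≤o (k + suc k) enough)))) ⟩
    replicate a 1 ++ multiples j β ++ replicate c x
      ↭⟨ ++⁺ˡ (replicate a 1) (++⁺ʳ (replicate c x) (multiples-concatMap j b)) ⟩
    replicate a 1 ++ concatMap g (upTo j) ++ replicate c x
      ≡⟨ cong (λ n → replicate a 1 ++ concatMap g (upTo n) ++ replicate c x) (m*n/n≡m j 2) ⟨
    theList x a b c ∎

-- From absolute differences to cyclic lengths.

path-length : Path s t V L → length V ≡ suc (length L)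
path-length stop     = ≡-refl
path-length (step p) = cong suc (path-length p)

pathLengths-path : ∀ v → Path s t V L → pathLengths v V ≡ map (λ d → d ⊓ (v ∸ d)) L
pathLengths-path v stop              = ≡-refl
pathLengths-path v (step stop)       = ≡-refl
pathLengths-path v (step p@(step _)) = cong (_ ∷_) (pathLengths-path v p)

short : ∀ v → d ≤ v / 2 → d ⊓ (v ∸ d) ≡ d
short {d = d} v d≤v/2 = m≤n⇒m⊓n≡m (m+n≤o⇒m≤o∸n d (begin
  d + d     ≡⟨ d+d d ⟩
  d * 2     ≤⟨ *-monoˡ-≤ 2 d≤v/2 ⟩
  v / 2 * 2 ≤⟨ m/n*n≤m v 2 ⟩
  v         ∎))
  where
  open ≤-Reasoning
  d+d : ∀ d → d + d ≡ d * 2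
  d+d = solve-∀

cyclic-realization : ∀ {N} → let v = suc (length L) in Admissible v L → Walk s t (downFrom N , L) →
  ∃ λ H → HamiltonianPath v H × (pathLengths v H ↭ L)
cyclic-realization {L = L} {N = N} (_ , bounds , _) (walk {V} {K} path (V↭ , K↭)) = V , hamiltonian , lengths↭
  where
  v = suc (length L)
  -- The constructions do not keep track of `N`; it is forced, as a path has one vertex more than it
  -- has edges.
  N≡v : N ≡ v
  N≡v = begin
    N                   ≡⟨ length-downFrom N ⟨
    length (downFrom N) ≡⟨ ↭-length V↭ ⟨
    length V            ≡⟨ path-length path ⟩
    suc (length K)      ≡⟨ cong suc (↭-length K↭) ⟩
    v                   ∎
    where open ≡-Reasoning
  open PermutationReasoning
  hamiltonian : V ↭ upTo v
  hamiltonian = begin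
    V                ↭⟨ V↭ ⟩
    downFrom N       ≡⟨ cong downFrom N≡v ⟩
    downFrom v       ≡⟨ reverse-upTo v ⟨
    reverse (upTo v) ↭⟨ ↭-reverse (upTo v) ⟩
    upTo v           ∎
  lengths↭ : pathLengths v V ↭ L
  lengths↭ = begin
    pathLengths v V                ≡⟨ pathLengths-path v path ⟩
    map (λ d → d ⊓ (v ∸ d)) K      ↭⟨ map⁺ _ K↭ ⟩
    map (λ d → d ⊓ (v ∸ d)) L      ≡⟨ map-id-local (All.map (λ (_ , d≤) → short v d≤) bounds) ⟩
    L                              ∎

theorem1p7 : (x c a : ℕ) (b : ℕ → ℕ) → 2 ≤ x → 1 ≤ c →
    Admissible (suc (length (theList x a b c))) (theList x a b c) →
    ((x % 2 ≡ 0 × x ∸ 1 ≤ a) ⊎ (x % 2 ≡ 1 × 3 * x ∸ 4 ≤ a)) →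
    ∃ λ H → HamiltonianPath (suc (length (theList x a b c))) H
          × (pathLengths (suc (length (theList x a b c))) H ↭ theList x a b c)
theorem1p7 x c a b 2≤x 1≤c admissible (inj₁ (even , a≥))
  with x / 2 | trans (m≡m%n+[m/n]*n x 2) (cong (_+ x / 2 * 2) even)
theorem1p7 x c a b () 1≤c admissible (inj₁ (even , a≥)) | zero | ≡-refl
... | suc k | ≡-refl = let _ , _ , _ , w = even-case k c a b a≥ in cyclic-realization admissible w
theorem1p7 x c a b 2≤x 1≤c admissible (inj₂ (odd , a≥))
  with x / 2 | trans (m≡m%n+[m/n]*n x 2) (cong (_+ x / 2 * 2) odd)
theorem1p7 x c a b (s≤s ()) 1≤c admissible (inj₂ (odd , a≥)) | zero | ≡-refl
... | suc k | ≡-refl = let _ , _ , _ , w = odd-case k c a b a≥ in cyclic-realization admissible w
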